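{- Let $k\ge1$ be an integer, let $G$ be a graph and let $A,B\subseteq V(G)$ satisfy $\mathrm{dist}(A,B)>2^k$ and \[\mathrm{tp}_k\big(G\langle X\mapsto A\rangle[N_{2^{k-1}-1}[A]]\big)=\mathrm{tp}_k\big(G\langle X\mapsto B\rangle[N_{2^{k-1}-1}[B]]\big).\] Let $\bar w\in V(G)^{|\bar y|}$ be a tuple of vertices with $\mathrm{dist}(\bar w,A\cup B)\ge 2^k$. Then for every first-order formula $\varphi(\bar y,x)$ of quantifier rank at most $k-1$ in the signature of $G$, \[G\langle A\rangle\models\exists x\in A\ \varphi(\bar w,x)\iff G\langle B\rangle\models\exists x\in B\ \varphi(\bar w,x).\]
   Context: Graphs are finite, loopless, undirected, with finitely many unary color predicates. $\mathrm{dist}(\bar a,\bar b)$ is the minimum distance between an element of $\bar a$ and one of $\bar b$ (sets or tuples); $N_r[S]$ is the set of vertices at distance at most $r$ from $S$. $G\langle X\mapsto W\rangle$ is $G$ expanded by a new unary predicate $X$ interpreted as $W$; $G\langle W\rangle$ denotes the expansion by a new unary predicate (also named $W$) interpreted as $W$, and $\exists x\in W\,\psi$ abbreviates $\exists x\,(W(x)\wedge\psi)$. $H[S]$ is the induced substructure (colors restricted). $\mathrm{tp}_k(H)$ is the set of first-order sentences of quantifier rank at most $k$ (over the signature of $H$) true in $H$; equality of types means the two structures satisfy the same such sentences. -}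

module Defs where

open import Level using (0ℓ)
open import Data.Empty using (⊥)
open import Data.Fin using (Fin; zero; suc)
open import Data.Fin.Subset using (Subset; _∈_)
open import Data.Nat using (ℕ; zero; suc; _⊔_; _≤_; _<_)
open import Data.Product using (∃; ∃-syntax; _×_)
open import Data.Refinement using (Refinement; value)
open import Data.Sum using (_⊎_)
open import Data.Vec using (Vec; []; _∷_; lookup)
open import Relation.Binary using (Rel; Decidable; Symmetric; Irreflexive)
open import Relation.Binary.PropositionalEquality using (_≡_)
open import Relation.Nullary using (¬_)
open import Relation.Unary using (Pred)

-- Graphs on the vertex set Fin n with c unary color predicates. Adjacency and
-- colors are decidable, so satisfaction of formulas is decidable as well and
-- the constructive reading of the semantics below agrees with the classical one.
record Graph (c n : ℕ) : Set₁ where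
  field
    _~_      : Rel (Fin n) 0ℓ
    _~?_     : Decidable _~_
    ~-sym    : Symmetric _~_
    ~-irrefl : Irreflexive _≡_ _~_
    color    : Fin c → Subset n

open Graph public using (color)

-- The new predicate gets index zero; the old color i gets index suc i.
_⟨X↦_⟩ : ∀ {c n} → Graph c n → Subset n → Graph (suc c) n
G ⟨X↦ W ⟩ = record
  { _~_      = _~_
  ; _~?_     = _~?_
  ; ~-sym    = ~-sym
  ; ~-irrefl = ~-irrefl
  ; color    = λ { zero → W ; (suc i) → Graph.color G i }
  }
  where open Graph G hiding (color)

data Walk {c n} (G : Graph c n) : ℕ → Fin n → Fin n → Set where
  []  : ∀ {u} → Walk G zero u u
  _∷_ : ∀ {l u v w} → Graph._~_ G u v → Walk G l v w → Walk G (suc l) u w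

-- dist(S, T) is the least length of a walk from S to T, and ∞ if there is none.
-- Comparisons with it are phrased in terms of all walk lengths.
Dist≥ Dist> : ∀ {c n} → Graph c n → (S T : Pred (Fin n) 0ℓ) → ℕ → Set
Dist≥ G S T d = ∀ {s t l} → S s → T t → Walk G l s t → d ≤ l
Dist> G S T d = ∀ {s t l} → S s → T t → Walk G l s t → d < l

N[_] : ∀ {c n} → ℕ → Graph c n → Subset n → Pred (Fin n) 0ℓ
N[ r ] G S v = ∃[ s ] ∃[ l ] s ∈ S × l ≤ r × Walk G l s v

-- Structures, possibly empty, with one binary and c unary relations.
record Structure (c : ℕ) : Set₁ where
  field
    Carrier : Set
    Edge    : Rel Carrier 0ℓ
    Color   : Fin c → Pred Carrier 0ℓ

open Structure public

⟦_⟧ : ∀ {c n} → Graph c n → Structure c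
⟦ G ⟧ = record
  { Carrier = Fin _
  ; Edge    = Graph._~_ G
  ; Color   = λ i v → v ∈ color G i
  }

-- The membership proofs in the carrier are irrelevant, so each vertex of S
-- occurs exactly once up to _≡_.
_[_] : ∀ {c n} → Graph c n → Pred (Fin n) 0ℓ → Structure c
G [ S ] = record
  { Carrier = Refinement (Fin _) S
  ; Edge    = λ u v → Graph._~_ G (value u) (value v)
  ; Color   = λ i v → value v ∈ color G i
  }

infix  8 _≐′_
infixr 7 _∧′_
infixr 6 _∨′_
infixr 5 _⇒′_

-- First-order formulas over c colors with free variables in Fin m (de Bruijn:
-- a quantifier binds variable zero of its body).
data Formula (c : ℕ) : ℕ → Set where
  _≐′_           : ∀ {m} → Fin m → Fin m → Formula c m
  edge           : ∀ {m} → Fin m → Fin m → Formula c m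
  col            : ∀ {m} → Fin c → Fin m → Formula c m
  ⊥′             : ∀ {m} → Formula c m
  ¬′_            : ∀ {m} → Formula c m → Formula c m
  _∧′_ _∨′_ _⇒′_ : ∀ {m} → Formula c m → Formula c m → Formula c m
  ∃′_ ∀′_        : ∀ {m} → Formula c (suc m) → Formula c m

Sentence : ℕ → Set
Sentence c = Formula c 0

qr : ∀ {c m} → Formula c m → ℕ
qr (i ≐′ j)   = 0
qr (edge i j) = 0
qr (col p i)  = 0
qr ⊥′         = 0
qr (¬′ φ)     = qr φ
qr (φ ∧′ ψ)   = qr φ ⊔ qr ψ
qr (φ ∨′ ψ)   = qr φ ⊔ qr ψ
qr (φ ⇒′ ψ)   = qr φ ⊔ qr ψ
qr (∃′ φ)     = suc (qr φ)
qr (∀′ φ)     = suc (qr φ)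

infix 4 _⊨_at_

_⊨_at_ : ∀ {c m} (M : Structure c) → Formula c m → Vec (Carrier M) m → Set
M ⊨ i ≐′ j   at ρ = lookup ρ i ≡ lookup ρ j
M ⊨ edge i j at ρ = Edge M (lookup ρ i) (lookup ρ j)
M ⊨ col p i  at ρ = Color M p (lookup ρ i)
M ⊨ ⊥′       at ρ = ⊥
M ⊨ ¬′ φ     at ρ = ¬ (M ⊨ φ at ρ)
M ⊨ φ ∧′ ψ   at ρ = (M ⊨ φ at ρ) × (M ⊨ ψ at ρ)
M ⊨ φ ∨′ ψ   at ρ = (M ⊨ φ at ρ) ⊎ (M ⊨ ψ at ρ)
M ⊨ φ ⇒′ ψ   at ρ = M ⊨ φ at ρ → M ⊨ ψ at ρ
M ⊨ ∃′ φ     at ρ = ∃ λ a → M ⊨ φ at (a ∷ ρ)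
M ⊨ ∀′ φ     at ρ = ∀ a → M ⊨ φ at (a ∷ ρ)

tp : ∀ {c} → ℕ → Structure c → Pred (Sentence c) 0ℓ
tp k M σ = qr σ ≤ k × M ⊨ σ at []

-- A formula in the signature of G, read in the signature of G ⟨X↦ W ⟩.
weaken : ∀ {c m} → Formula c m → Formula (suc c) m
weaken (i ≐′ j)   = i ≐′ j
weaken (edge i j) = edge i j
weaken (col p i)  = col (suc p) i
weaken ⊥′         = ⊥′
weaken (¬′ φ)     = ¬′ weaken φ
weaken (φ ∧′ ψ)   = weaken φ ∧′ weaken ψ
weaken (φ ∨′ ψ)   = weaken φ ∨′ weaken ψ
weaken (φ ⇒′ ψ)   = weaken φ ⇒′ weaken ψ
weaken (∃′ φ)     = ∃′ weaken φ
weaken (∀′ φ)     = ∀′ weaken φ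

-- ∃ x (X(x) ∧ ψ), where X is the predicate added by _⟨X↦_⟩.
∃∈X_ : ∀ {c m} → Formula (suc c) (suc m) → Formula (suc c) m
∃∈X ψ = ∃′ (col zero zero ∧′ ψ)

{-# OPTIONS --safe #-}
-- By equality of k-types, a ∈ A can be matched with some b ∈ B (and conversely)
-- such that Duplicator wins the (k-1)-round Ehrenfeucht–Fraïssé game on the two
-- balls with a and b pebbled. This local strategy is turned into a strategy on
-- (G, w̄, a) versus (G, w̄, b): with j rounds left, a vertex within distance 2^j of
-- a locally pebbled vertex is answered in the opposite ball, and every other
-- vertex is answered by itself. Each local pair (p, p′) is treated as pebbled on
-- both sides in both orders, so that the local moves act as a partial swap of
-- the two balls. Duplicator preserves distances up to 2^j with j rounds left,
-- which keeps the vertices answered by themselves far from the swapped ones.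
module Submission where

open import Defs
open import Data.Fin using (Fin; zero; suc)
open import Data.Fin.Properties using (any?) renaming (_≟_ to _≟ᶠ_)
open import Data.Fin.Subset using (Subset; _∈_; _∪_)
open import Data.Fin.Subset.Properties using (_∈?_; p⊆p∪q; q⊆p∪q)
open import Data.Irrelevant using () renaming ([_] to irr)
open import Data.List using (List; []; _∷_; allFin; concatMap)
open import Data.List.Membership.Propositional using (lose) renaming (_∈_ to _∈ₗ_)
open import Data.List.Membership.Propositional.Properties using (∈-allFin; ∈-concatMap⁺)
open import Data.List.Relation.Unary.All as All using (All; []; _∷_)
open import Data.List.Relation.Unary.Any using (here)
open import Data.Nat using (ℕ; zero; suc; z≤n; s≤s; s≤s⁻¹; _+_; _⊓_; _^_; _∸_; _≤_; _<_)
open import Data.Nat.Properties using (≤-refl; ≤-reflexive; ≤-trans; <-≤-trans; <-irrefl; ≰⇒>; ⊔-lub; m⊔n≤o⇒m≤o; m⊔n≤o⇒n≤o; m≤m+n; n≤1+n; m⊓n≤m; m⊓n+n∸m≡n; m≤n+o⇒m∸n≤o; ∸-monoˡ-≤; m^n>0; +-comm; +-assoc; +-identityʳ; +-mono-≤; +-monoˡ-≤; +-monoʳ-≤; +-cancelˡ-<; anyUpTo?; module ≤-Reasoning)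
open import Data.Product using (∃; ∃-syntax; _×_; _,_; proj₁; proj₂)
open import Data.Product.Function.NonDependent.Propositional using (_×-⇔_)
open import Data.Refinement using (value; value-injective; _,_) renaming (_≟_ to ≟-Refinement)
open import Data.Sum using (_⊎_; inj₁; inj₂; swap; map₁)
open import Data.Sum.Function.Propositional using (_⊎-⇔_)
open import Data.Vec using (Vec; []; _∷_; lookup)
open import Data.Vec.Membership.Propositional using () renaming (_∈_ to _∈ᵥ_)
open import Data.Vec.Membership.Propositional.Properties using (∈-lookup)
open import Function using (_∘_; case_of_)
open import Function.Bundles using (_⇔_; mk⇔; module Equivalence)
open import Function.Construct.Composition using (_⇔-∘_)
open import Function.Construct.Identity using (⇔-id)
open import Function.Construct.Symmetry using (⇔-sym)
open import Function.Related.TypeIsomorphisms using (→-cong-⇔; ¬-cong-⇔)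
open import Level using (0ℓ)
open import Relation.Binary using (Decidable; DecidableEquality)
open import Relation.Binary.PropositionalEquality using (_≡_; refl; sym; trans; cong; subst)
open import Relation.Nullary using (¬_; Dec; yes; no; contradiction; contradiction-irr)
open import Relation.Nullary.Decidable using (map′; _×-dec_)
open import Relation.Unary using (Pred; _≐_; _⊆_)

open Equivalence using (to; from)

-- Powers of two.

2^suc : ∀ j → 2 ^ suc j ≡ 2 ^ j + 2 ^ j
2^suc j = cong (2 ^ j +_) (+-identityʳ (2 ^ j))

2^-mono-suc : ∀ j → 2 ^ j ≤ 2 ^ suc j
2^-mono-suc j = m≤m+n (2 ^ j) _

-- Ehrenfeucht–Fraïssé games

record SameAtoms {c} (M N : Structure c) {m} (p : Vec (Carrier M) m) (q : Vec (Carrier N) m) : Set where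
  field
    same-≡     : ∀ i j → (lookup p i ≡ lookup p j) ⇔ (lookup q i ≡ lookup q j)
    same-edge  : ∀ i j → Edge M (lookup p i) (lookup p j) ⇔ Edge N (lookup q i) (lookup q j)
    same-color : ∀ a i → Color M a (lookup p i) ⇔ Color N a (lookup q i)

open SameAtoms

-- The atoms are stored at every stage, so that they can be read off while rounds are still left.
data BackForth {c} (M N : Structure c) : ℕ → ∀ {m} → Vec (Carrier M) m → Vec (Carrier N) m → Set where
  stop : ∀ {m} {p : Vec (Carrier M) m} {q : Vec (Carrier N) m} →
         SameAtoms M N p q → BackForth M N zero p q
  step : ∀ {j m} {p : Vec (Carrier M) m} {q : Vec (Carrier N) m} →
         SameAtoms M N p q →
         (∀ x → ∃ λ y → BackForth M N j (x ∷ p) (y ∷ q)) →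
         (∀ y → ∃ λ x → BackForth M N j (x ∷ p) (y ∷ q)) →
         BackForth M N (suc j) p q

module _ {c} {M N : Structure c} where

  atoms : ∀ {j m} {p : Vec (Carrier M) m} {q : Vec (Carrier N) m} → BackForth M N j p q → SameAtoms M N p q
  atoms (stop at)     = at
  atoms (step at _ _) = at

  forth : ∀ {j m} {p : Vec (Carrier M) m} {q : Vec (Carrier N) m} →
          BackForth M N (suc j) p q → ∀ x → ∃ λ y → BackForth M N j (x ∷ p) (y ∷ q)
  forth (step _ f _) = f

  back : ∀ {j m} {p : Vec (Carrier M) m} {q : Vec (Carrier N) m} →
         BackForth M N (suc j) p q → ∀ y → ∃ λ x → BackForth M N j (x ∷ p) (y ∷ q)
  back (step _ _ b) = b

  BackForth-pred : ∀ {j m} {p : Vec (Carrier M) m} {q : Vec (Carrier N) m} →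
                   BackForth M N (suc j) p q → BackForth M N j p q
  BackForth-pred {zero}  (step at _ _) = stop at
  BackForth-pred {suc j} (step at f b) = step at
    (λ x → let y , bf = f x in y , BackForth-pred bf)
    (λ y → let x , bf = b y in x , BackForth-pred bf)

  BackForth⇒⊨ : ∀ {j m} {p : Vec (Carrier M) m} {q : Vec (Carrier N) m} → BackForth M N j p q →
                ∀ φ → qr φ ≤ j → (M ⊨ φ at p) ⇔ (N ⊨ φ at q)
  BackForth⇒⊨ bf (i ≐′ j)   _  = same-≡ (atoms bf) i j
  BackForth⇒⊨ bf (edge i j) _  = same-edge (atoms bf) i j
  BackForth⇒⊨ bf (col a i)  _  = same-color (atoms bf) a i
  BackForth⇒⊨ bf ⊥′         _  = ⇔-id _
  BackForth⇒⊨ bf (¬′ φ)     le = ¬-cong-⇔ (BackForth⇒⊨ bf φ le)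
  BackForth⇒⊨ bf (φ ∧′ ψ)   le =
    BackForth⇒⊨ bf φ (m⊔n≤o⇒m≤o _ _ le) ×-⇔ BackForth⇒⊨ bf ψ (m⊔n≤o⇒n≤o (qr φ) _ le)
  BackForth⇒⊨ bf (φ ∨′ ψ)   le =
    BackForth⇒⊨ bf φ (m⊔n≤o⇒m≤o _ _ le) ⊎-⇔ BackForth⇒⊨ bf ψ (m⊔n≤o⇒n≤o (qr φ) _ le)
  BackForth⇒⊨ bf (φ ⇒′ ψ)   le =
    →-cong-⇔ (BackForth⇒⊨ bf φ (m⊔n≤o⇒m≤o _ _ le)) (BackForth⇒⊨ bf ψ (m⊔n≤o⇒n≤o (qr φ) _ le))
  BackForth⇒⊨ (step _ f b) (∃′ φ) (s≤s le) = mk⇔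
    (λ (x , t) → let y , bf = f x in y , to (BackForth⇒⊨ bf φ le) t)
    (λ (y , t) → let x , bf = b y in x , from (BackForth⇒⊨ bf φ le) t)
  BackForth⇒⊨ (step _ f b) (∀′ φ) (s≤s le) = mk⇔
    (λ t y → let x , bf = b y in to (BackForth⇒⊨ bf φ le) (t x))
    (λ t x → let y , bf = f x in from (BackForth⇒⊨ bf φ le) (t y))

BackForth-sym : ∀ {c} {M N : Structure c} {j m} {p : Vec (Carrier M) m} {q : Vec (Carrier N) m} →
                BackForth M N j p q → BackForth N M j q p
BackForth-sym {M = M} {N} = go
  where
  sym-atoms : ∀ {m} {p : Vec (Carrier M) m} {q : Vec (Carrier N) m} → SameAtoms M N p q → SameAtoms N M q p
  sym-atoms at = record
    { same-≡     = λ i j → ⇔-sym (same-≡ at i j)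
    ; same-edge  = λ i j → ⇔-sym (same-edge at i j)
    ; same-color = λ a i → ⇔-sym (same-color at a i)
    }
  go : ∀ {j m} {p : Vec (Carrier M) m} {q : Vec (Carrier N) m} → BackForth M N j p q → BackForth N M j q p
  go (stop at)     = stop (sym-atoms at)
  go (step at f b) = step (sym-atoms at)
    (λ y → let x , bf = b y in x , go bf)
    (λ x → let y , bf = f x in y , go bf)

-- Finite structures: either Duplicator wins or some formula separates

record Finite (X : Set) : Set where
  field
    elements : List X
    complete : ∀ x → x ∈ₗ elements

open Finite

Fin-finite : ∀ {n} → Finite (Fin n)
Fin-finite {n} = record { elements = allFin n ; complete = ∈-allFin }

-- Running through the list of elements either meets a `Q` or collects every `P x`. This replaces
-- excluded middle and keeps the analysis of the game constructive.
distrib-∀ : ∀ {X Q : Set} {P : Pred X 0ℓ} → Finite X → (∀ x → Q ⊎ P x) → Q ⊎ (∀ x → P x)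
distrib-∀ {X} {Q} {P} fin f = case go (elements fin) of λ where
    (inj₁ q)  → inj₁ q
    (inj₂ ps) → inj₂ λ x → All.lookup ps (complete fin x)
  where
  go : ∀ xs → Q ⊎ All P xs
  go []       = inj₂ []
  go (x ∷ xs) with f x | go xs
  ... | inj₁ q | _       = inj₁ q
  ... | inj₂ _ | inj₁ q  = inj₁ q
  ... | inj₂ p | inj₂ ps = inj₂ (p ∷ ps)

record FiniteStructure {c} (M : Structure c) : Set where
  field
    finite : Finite (Carrier M)
    _≟_    : DecidableEquality (Carrier M)
    edge?  : Decidable (Edge M)
    color? : ∀ a x → Dec (Color M a x)

Separated : ∀ {c} (M N : Structure c) → ℕ → ∀ {m} → Vec (Carrier M) m → Vec (Carrier N) m → Set
Separated M N j p q = ∃ λ φ → qr φ ≤ j × (M ⊨ φ at p) × ¬ (N ⊨ φ at q)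

Separated-sym : ∀ {c} {M N : Structure c} {j m} {p : Vec (Carrier M) m} {q : Vec (Carrier N) m} →
                Separated M N j p q → Separated N M j q p
-- Negation keeps the quantifier rank.
Separated-sym (φ , le , t , f) = ¬′ φ , le , f , λ nt → nt t

-- One formula has to rule out every reply to `x`: take the conjunction of the formulas that rule
-- out the single replies. Its rank is still at most `j`, and the quantifier over `x` costs one
-- more.
Separated-∃ : ∀ {c} {M N : Structure c} {j m} {p : Vec (Carrier M) m} {q : Vec (Carrier N) m} →
              Finite (Carrier N) → ∀ x → (∀ y → Separated M N j (x ∷ p) (y ∷ q)) → Separated M N (suc j) p q
Separated-∃ {c} {M} {N} {j} {p = p} {q} fin x sep =
  let φ , le , t , fs = conj (elements fin)
  in  ∃′ φ , s≤s le , (x , t) , λ (y , t′) → All.lookup fs (complete fin y) t′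
  where
  conj : ∀ ys → ∃ λ (φ : Formula c _) → qr φ ≤ j × (M ⊨ φ at (x ∷ p)) × All (λ y → ¬ (N ⊨ φ at (y ∷ q))) ys
  -- The empty conjunction, in a language without a constant for truth.
  conj []       = ¬′ ⊥′ , z≤n , (λ ()) , []
  conj (y ∷ ys) =
    let φ , le , t , f   = sep y
        ψ , le′ , u , fs = conj ys
    in  φ ∧′ ψ , ⊔-lub le le′ , (t , u) , (f ∘ proj₁) ∷ All.map (_∘ proj₂) fs

module _ {c} {M N : Structure c} (finM : FiniteStructure M) (finN : FiniteStructure N) where

  private
    module FM = FiniteStructure finM
    module FN = FiniteStructure finN

  agree-or-separated : ∀ {j m} {p : Vec (Carrier M) m} {q : Vec (Carrier N) m} φ → qr φ ≤ j →
                       Dec (M ⊨ φ at p) → Dec (N ⊨ φ at q) →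
                       Separated M N j p q ⊎ ((M ⊨ φ at p) ⇔ (N ⊨ φ at q))
  agree-or-separated φ le (yes t) (yes u) = inj₂ (mk⇔ (λ _ → u) (λ _ → t))
  agree-or-separated φ le (yes t) (no ¬u) = inj₁ (φ , le , t , ¬u)
  agree-or-separated φ le (no ¬t) (yes u) = inj₁ (¬′ φ , le , ¬t , λ ¬u → ¬u u)
  agree-or-separated φ le (no ¬t) (no ¬u) = inj₂ (mk⇔ (λ t → contradiction t ¬t) (λ u → contradiction u ¬u))

  atoms-or-separated : ∀ j {m} (p : Vec (Carrier M) m) (q : Vec (Carrier N) m) →
                       Separated M N j p q ⊎ SameAtoms M N p q
  atoms-or-separated j p q with
      distrib-∀ Fin-finite (λ i → distrib-∀ Fin-finite λ i′ →
        agree-or-separated {j} {p = p} {q} (i ≐′ i′) z≤n (_ FM.≟ _) (_ FN.≟ _))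
    | distrib-∀ Fin-finite (λ i → distrib-∀ Fin-finite λ i′ →
        agree-or-separated {j} {p = p} {q} (edge i i′) z≤n (FM.edge? _ _) (FN.edge? _ _))
    | distrib-∀ Fin-finite (λ a → distrib-∀ Fin-finite λ i →
        agree-or-separated {j} {p = p} {q} (col a i) z≤n (FM.color? _ _) (FN.color? _ _))
  ... | inj₁ s | _      | _      = inj₁ s
  ... | inj₂ _ | inj₁ s | _      = inj₁ s
  ... | inj₂ _ | inj₂ _ | inj₁ s = inj₁ s
  ... | inj₂ e | inj₂ f | inj₂ g = inj₂ record { same-≡ = e ; same-edge = f ; same-color = g }

  -- Determinacy, by induction on the rounds: a move without a good reply is separated from all
  -- replies, and `Separated-∃` merges these separations into one.
  BackForth-or-Separated : ∀ j {m} (p : Vec (Carrier M) m) (q : Vec (Carrier N) m) →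
                           Separated M N j p q ⊎ BackForth M N j p q
  BackForth-or-Separated zero    p q with atoms-or-separated zero p q
  ... | inj₁ s  = inj₁ s
  ... | inj₂ at = inj₂ (stop at)
  BackForth-or-Separated (suc j) p q with
      atoms-or-separated (suc j) p q
    | distrib-∀ FM.finite (λ x → answer-forth x)
    | distrib-∀ FN.finite (λ y → answer-back y)
    where
    answer-forth : ∀ x → Separated M N (suc j) p q ⊎ ∃ λ y → BackForth M N j (x ∷ p) (y ∷ q)
    -- The constant alternative in `distrib-∀` is here a winning reply, hence the `swap`.
    answer-forth x = map₁ (Separated-∃ FN.finite x) (swap (distrib-∀ FN.finite λ y →
      case BackForth-or-Separated j (x ∷ p) (y ∷ q) of λ where
        (inj₁ s)  → inj₂ s
        (inj₂ bf) → inj₁ (y , bf)))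
    answer-back : ∀ y → Separated M N (suc j) p q ⊎ ∃ λ x → BackForth M N j (x ∷ p) (y ∷ q)
    -- For a move in `N` the formula is built with the two structures exchanged and negated at the
    -- end.
    answer-back y = map₁ (λ s → Separated-sym (Separated-∃ FM.finite y (λ x → Separated-sym (s x))))
      (swap (distrib-∀ FM.finite λ x →
        case BackForth-or-Separated j (x ∷ p) (y ∷ q) of λ where
          (inj₁ s)  → inj₂ s
          (inj₂ bf) → inj₁ (x , bf)))
  ... | inj₁ s  | _      | _      = inj₁ s
  ... | inj₂ _  | inj₁ s | _      = inj₁ s
  ... | inj₂ _  | inj₂ _ | inj₁ s = inj₁ s
  ... | inj₂ at | inj₂ f | inj₂ b = inj₂ (step at f b)

  -- A separating sentence would lie in the first type but not in the second.
  tp⊆⇒BackForth : ∀ k → tp k M ⊆ tp k N → BackForth M N k [] []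
  tp⊆⇒BackForth k M⊆N with BackForth-or-Separated k [] []
  ... | inj₁ (σ , le , t , ¬u) = contradiction (proj₂ (M⊆N {σ} (le , t))) ¬u
  ... | inj₂ bf                = bf

-- Formulas that do not mention the new predicate.

weaken-⊨ : ∀ {c n} (G : Graph c n) (W : Subset n) {m} (φ : Formula c m) {ρ : Vec (Fin n) m} →
           (⟦ G ⟨X↦ W ⟩ ⟧ ⊨ weaken φ at ρ) ⇔ (⟦ G ⟧ ⊨ φ at ρ)
weaken-⊨ G W (i ≐′ j)   = ⇔-id _
weaken-⊨ G W (edge i j) = ⇔-id _
weaken-⊨ G W (col a i)  = ⇔-id _
weaken-⊨ G W ⊥′         = ⇔-id _
weaken-⊨ G W (¬′ φ)     = ¬-cong-⇔ (weaken-⊨ G W φ)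
weaken-⊨ G W (φ ∧′ ψ)   = weaken-⊨ G W φ ×-⇔ weaken-⊨ G W ψ
weaken-⊨ G W (φ ∨′ ψ)   = weaken-⊨ G W φ ⊎-⇔ weaken-⊨ G W ψ
weaken-⊨ G W (φ ⇒′ ψ)   = →-cong-⇔ (weaken-⊨ G W φ) (weaken-⊨ G W ψ)
weaken-⊨ G W (∃′ φ)     = mk⇔ (λ (x , t) → x , to (weaken-⊨ G W φ) t) (λ (x , t) → x , from (weaken-⊨ G W φ) t)
weaken-⊨ G W (∀′ φ)     = mk⇔ (λ t x → to (weaken-⊨ G W φ) (t x)) (λ t x → from (weaken-⊨ G W φ) (t x))

module _ {c n} (G : Graph c n) where

  open Graph G using (_~_; _~?_; ~-sym)

  -- Walks

  infixr 5 _++_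

  _++_ : ∀ {l l′ u v w} → Walk G l u v → Walk G l′ v w → Walk G (l + l′) u w
  []      ++ q = q
  (e ∷ p) ++ q = e ∷ (p ++ q)

  split : ∀ l {l′ u w} → Walk G (l + l′) u w → ∃ λ v → Walk G l u v × Walk G l′ v w
  split zero    p       = _ , [] , p
  split (suc l) (e ∷ p) = let v , p₁ , p₂ = split l p in v , e ∷ p₁ , p₂

  reverse : ∀ {l u v} → Walk G l u v → Walk G l v u
  reverse                 []      = []
  reverse {suc l} {u} {v} (e ∷ p) = subst (λ d → Walk G d v u) (+-comm l 1) (reverse p ++ (~-sym e ∷ []))

  Dist>-sym : ∀ {S T : Pred (Fin n) 0ℓ} {d} → Dist> G S T d → Dist> G T S d
  Dist>-sym dist t s w = dist s t (reverse w)

  walk-zero⇒≡ : ∀ {u v} → Walk G 0 u v → u ≡ v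
  walk-zero⇒≡ [] = refl

  ≡⇒walk-zero : ∀ {u v} → u ≡ v → Walk G 0 u v
  ≡⇒walk-zero refl = []

  walk-one⇒~ : ∀ {u v} → Walk G 1 u v → u ~ v
  walk-one⇒~ (e ∷ []) = e

  -- Decidability of distances and finiteness of induced substructures.

  walk? : ∀ l u v → Dec (Walk G l u v)
  walk? zero    u v = map′ ≡⇒walk-zero walk-zero⇒≡ (u ≟ᶠ v)
  walk? (suc l) u v = map′ (λ (_ , e , p) → e ∷ p) (λ { (e ∷ p) → _ , e , p })
    (any? λ x → (u ~? x) ×-dec walk? l x v)

  Within : ℕ → Fin n → Fin n → Set
  Within d u v = ∃ λ l → l ≤ d × Walk G l u v

  within? : ∀ d u v → Dec (Within d u v)
  within? d u v = map′ (λ (l , lt , p) → l , s≤s⁻¹ lt , p) (λ (l , le , p) → l , s≤s le , p)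
    -- `anyUpTo?` searches strictly below its bound.
    (anyUpTo? (λ l → walk? l u v) (suc d))

  N? : ∀ r S v → Dec (N[ r ] G S v)
  N? r S v = map′ (λ (s , s∈ , l , le , p) → s , l , s∈ , le , p) (λ (s , l , s∈ , le , p) → s , s∈ , l , le , p)
    (any? λ s → (s ∈? S) ×-dec within? r s v)

  module _ {c′} (H : Graph c′ n) {S : Pred (Fin n) 0ℓ} (S? : ∀ v → Dec (S v)) where

    private
      restrict : ∀ v → Dec (S v) → List (Carrier (H [ S ]))
      restrict v (yes s) = (v , irr s) ∷ []
      restrict v (no _)  = []

      restrict-complete : ∀ x d → x ∈ₗ restrict (value x) d
      -- Membership proofs are irrelevant, so the one found by `S?` agrees with the given one.
      restrict-complete (v , irr s) (yes _) = here refl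
      restrict-complete (v , irr s) (no ¬s) = contradiction-irr s ¬s

    induced-finite : FiniteStructure (H [ S ])
    induced-finite = record
      { finite = record
          { elements = concatMap (λ v → restrict v (S? v)) (allFin n)
          ; complete = λ x → ∈-concatMap⁺ (λ v → restrict v (S? v)) (lose (∈-allFin (value x)) (restrict-complete x (S? (value x))))
          }
      ; _≟_    = ≟-Refinement _≟ᶠ_
      ; edge?  = λ u v → Graph._~?_ H (value u) (value v)
      ; color? = λ a v → value v ∈? color H a
      }

  Ball : ℕ → Subset n → Structure (suc c)
  Ball r A = (G ⟨X↦ A ⟩) [ N[ r ] G A ]

  -- Halving the walk costs one round per factor of two. The bound e + d ≤ r
  -- keeps the midpoints inside the ball.
  BackForth-walk : ∀ {r A B j m} {p : Vec (Carrier (Ball r A)) m} {q : Vec (Carrier (Ball r B)) m} →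
                   BackForth (Ball r A) (Ball r B) j p q → ∀ a b {s e d} →
                   s ∈ A → Walk G e s (value (lookup p a)) → e + d ≤ r → d ≤ 2 ^ j →
                   Walk G d (value (lookup p a)) (value (lookup p b)) →
                   Walk G d (value (lookup q a)) (value (lookup q b))
  -- With no round left the bound is 2 ^ 0 = 1: only equality and adjacency remain, and both are
  -- atoms.
  BackForth-walk {j = zero} bf a b {d = 0} _ _ _ _ w =
    ≡⇒walk-zero (cong value (to (same-≡ (atoms bf) a b) (value-injective (walk-zero⇒≡ w))))
  BackForth-walk {j = zero} bf a b {d = 1} _ _ _ _ w =
    to (same-edge (atoms bf) a b) (walk-one⇒~ w) ∷ []
  BackForth-walk {j = zero} bf a b {d = suc (suc d)} _ _ _ (s≤s ()) w
  BackForth-walk {r} {A} {j = suc j} {p = p} {q} bf a b {s} {e} {d} s∈A p₀ e+d≤r d≤ w =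
    subst (λ l → Walk G l _ _) d₁+d₂≡d (halves (split d₁ (subst (λ l → Walk G l _ _) (sym d₁+d₂≡d) w)))
    where
    -- Both parts are at most `2 ^ j` and add up to exactly `d`, also when `d` is below `2 ^ j` and
    -- the second part is empty.
    d₁ = 2 ^ j ⊓ d
    d₂ = d ∸ 2 ^ j
    d₁+d₂≡d : d₁ + d₂ ≡ d
    d₁+d₂≡d = m⊓n+n∸m≡n (2 ^ j) d
    e+d₁+d₂≤r : e + d₁ + d₂ ≤ r
    e+d₁+d₂≤r = ≤-trans (≤-reflexive (trans (+-assoc e d₁ d₂) (cong (e +_) d₁+d₂≡d))) e+d≤r
    e+d₁≤r : e + d₁ ≤ r
    e+d₁≤r = ≤-trans (m≤m+n (e + d₁) d₂) e+d₁+d₂≤r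
    halves : (∃ λ x → Walk G d₁ (value (lookup p a)) x × Walk G d₂ x (value (lookup p b))) →
             Walk G (d₁ + d₂) (value (lookup q a)) (value (lookup q b))
    halves (x , w₁ , w₂) =
      -- Pebbling the midpoint shifts the old pebbles to `suc a` and `suc b`.
      let y , bf′ = forth bf (x , irr (s , e + d₁ , s∈A , e+d₁≤r , p₀ ++ w₁))
      in BackForth-walk bf′ (suc a) zero s∈A p₀ e+d₁≤r (m⊓n≤m (2 ^ j) d) w₁
         ++ BackForth-walk bf′ zero (suc b) s∈A (p₀ ++ w₁) e+d₁+d₂≤r
              (m≤n+o⇒m∸n≤o d (2 ^ j) (≤-trans d≤ (≤-reflexive (2^suc j)))) w₂

  -- The global strategy

  module _ (k : ℕ) where

    private
      -- Here `k` counts the rounds left once the two witnesses are pebbled, so it is one less than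
      -- in the theorem.
      M : Subset n → Structure (suc c)
      M = Ball (2 ^ k ∸ 1)

    -- A budget: a pebble that is `e` steps away from `S` still has `2 ^ j` of the total `2 ^ k` in
    -- reserve for the remaining rounds.
    Close : ℕ → Subset n → Fin n → Set
    Close j S v = ∃[ s ] ∃[ e ] s ∈ S × e + 2 ^ j ≤ 2 ^ k × Walk G e s v

    Far : ∀ {S l} → ℕ → Vec (Carrier (M S)) l → Fin n → Set
    Far j p z = ∀ i {d} → Walk G d (value (lookup p i)) z → 2 ^ j < d

    Near : ∀ {S l} → ℕ → Vec (Carrier (M S)) l → Fin n → Set
    Near j p x = ∃ λ i → Within (2 ^ j) (value (lookup p i)) x

    near? : ∀ {S l} j (p : Vec (Carrier (M S)) l) x → Dec (Near j p x)
    near? j p x = any? λ i → within? (2 ^ j) (value (lookup p i)) x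

    ¬Near⇒Far : ∀ {S l j} {p : Vec (Carrier (M S)) l} {x} → ¬ Near j p x → Far j p x
    ¬Near⇒Far ¬near i w = ≰⇒> λ le → ¬near (i , _ , le , w)

    Close-pred : ∀ {j S v} → Close (suc j) S v → Close j S v
    Close-pred {j} (s , e , s∈ , le , w) = s , e , s∈ , ≤-trans (+-monoʳ-≤ e (2^-mono-suc j)) le , w

    Far-pred : ∀ {j S l} {p : Vec (Carrier (M S)) l} {z} → Far (suc j) p z → Far j p z
    Far-pred {j} far i w = ≤-trans (s≤s (2^-mono-suc j)) (far i w)

    -- The reserve `2 ^ suc j` splits into `2 ^ j` for the walk to the new pebble and `2 ^ j` for
    -- later rounds.
    Close-extend : ∀ {j S u v d} → Close (suc j) S u → d ≤ 2 ^ j → Walk G d u v → Close j S v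
    Close-extend {j} {d = d} (s , e , s∈ , le , w) d≤ w′ = s , e + d , s∈ , bound , w ++ w′
      where
      open ≤-Reasoning
      bound : e + d + 2 ^ j ≤ 2 ^ k
      bound = begin
        e + d + 2 ^ j         ≡⟨ +-assoc e d (2 ^ j) ⟩
        e + (d + 2 ^ j)       ≤⟨ +-monoʳ-≤ e (+-monoˡ-≤ (2 ^ j) d≤) ⟩
        e + (2 ^ j + 2 ^ j)   ≡⟨ cong (e +_) (2^suc j) ⟨
        e + 2 ^ suc j         ≤⟨ le ⟩
        2 ^ k                 ∎

    -- Triangle inequality: a walk of length at most `2 ^ j` from the new pebble to `z`, prefixed by
    -- `w`, would bring `z` within `2 ^ suc j` of pebble `i`.
    Far-extend : ∀ {j S l} {p : Vec (Carrier (M S)) l} {x z d} i →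
                 d ≤ 2 ^ j → Walk G d (value (lookup p i)) (value x) →
                 Far (suc j) p z → Far j (x ∷ p) z
    Far-extend {j} {p = p} {z = z} {d} i d≤ w far zero {d′} w′ = +-cancelˡ-< (2 ^ j) (2 ^ j) d′
      (<-≤-trans (subst (_< d + d′) (2^suc j) (far i (w ++ w′))) (+-monoˡ-≤ d′ d≤))
    Far-extend {j} {p = p} i d≤ w far (suc i′) w′ = Far-pred {j} {p = p} far i′ w′

    -- The reserve is at least one, which is why balls of radius `2 ^ k ∸ 1` contain all local
    -- pebbles.
    Close⇒< : ∀ {j S v} ((_ , e , _) : Close j S v) → suc e ≤ 2 ^ k
    Close⇒< {j} (s , e , _ , le , _) =
      ≤-trans (≤-trans (≤-reflexive (+-comm 1 e)) (+-monoʳ-≤ e (m^n>0 2 j))) le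

    Close⇒N : ∀ {j S v} → Close j S v → N[ 2 ^ k ∸ 1 ] G S v
    Close⇒N {j} cl@(s , e , s∈ , _ , w) = s , e , s∈ , ∸-monoˡ-≤ 1 (Close⇒< {j} cl) , w

    -- Both vertices are at most 2 ^ k - 1 steps from their sets, so one more edge would join `A` to
    -- `B` by a walk shorter than `2 ^ suc k`.
    Close⇒¬Within-one : ∀ {A B j u v} → Dist> G (_∈ A) (_∈ B) (2 ^ suc k) →
                        Close j A u → Close j B v → ¬ Within 1 u v
    Close⇒¬Within-one {j = j} dist cu@(_ , e , s∈ , _ , p) cv@(_ , e′ , t∈ , _ , p′) (d , d≤1 , w) =
      <-irrefl refl (<-≤-trans (dist s∈ t∈ (p ++ w ++ reverse p′)) bound)
      where
      open ≤-Reasoning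
      bound : e + (d + e′) ≤ 2 ^ suc k
      bound = begin
        e + (d + e′)     ≤⟨ +-monoʳ-≤ e (+-monoˡ-≤ e′ d≤1) ⟩
        e + suc e′       ≤⟨ n≤1+n _ ⟩
        suc e + suc e′   ≤⟨ +-mono-≤ (Close⇒< {j} cu) (Close⇒< {j} cv) ⟩
        2 ^ k + 2 ^ k    ≡⟨ 2^suc k ⟨
        2 ^ suc k        ∎

    -- The invariant of the global game.

    -- `bwd` covers a left-hand vertex that lies in the ball of `B`. A vertex that stays must be far
    -- from the pebbles of both balls, since both are moved by the swap.
    data Link {A B l} (j : ℕ) (p : Vec (Carrier (M A)) l) (q : Vec (Carrier (M B)) l) : Fin n → Fin n → Set where
      stay : ∀ {z} → Far j p z → Far j q z → Link j p q z z
      fwd  : ∀ i → Link j p q (value (lookup p i)) (value (lookup q i))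
      bwd  : ∀ i → Link j p q (value (lookup q i)) (value (lookup p i))

    -- `pairs` is independent of `m`, because a vertex answered by itself adds no local pair.
    record Position (A B : Subset n) (j : ℕ) {m} (ρ ρ′ : Vec (Fin n) m) : Set where
      field
        {pairs} : ℕ
        p       : Vec (Carrier (M A)) pairs
        q       : Vec (Carrier (M B)) pairs
        apart   : Dist> G (_∈ A) (_∈ B) (2 ^ suc k)
        local   : BackForth (M A) (M B) j p q
        close-p : ∀ i → Close j A (value (lookup p i))
        close-q : ∀ i → Close j B (value (lookup q i))
        links   : ∀ i → Link j p q (lookup ρ i) (lookup ρ′ i)

    -- Reduces a move near `q` to a move near `p`.
    swap-balls : ∀ {A B j m} {ρ ρ′ : Vec (Fin n) m} → Position A B j ρ ρ′ → Position B A j ρ ρ′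
    swap-balls {A} {B} {j} P = record
      { p = P.q ; q = P.p ; apart = Dist>-sym P.apart ; local = BackForth-sym P.local
      ; close-p = P.close-q ; close-q = P.close-p ; links = λ i → swap-link (P.links i) }
      where
      module P = Position P
      swap-link : ∀ {u v} → Link j P.p P.q u v → Link j P.q P.p u v
      swap-link (stay f g) = stay g f
      swap-link (fwd i)    = bwd i
      swap-link (bwd i)    = fwd i

    -- The partial swap is its own inverse. This turns Spoiler's moves on the right into moves on
    -- the left and supplies the converse implications for atoms.
    swap-sides : ∀ {A B j m} {ρ ρ′ : Vec (Fin n) m} → Position A B j ρ ρ′ → Position A B j ρ′ ρ
    swap-sides {A} {B} {j} P = record
      { p = P.p ; q = P.q ; apart = P.apart ; local = P.local
      ; close-p = P.close-p ; close-q = P.close-q ; links = λ i → swap-link (P.links i) }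
      where
      module P = Position P
      swap-link : ∀ {u v} → Link j P.p P.q u v → Link j P.p P.q v u
      swap-link (stay f g) = stay f g
      swap-link (fwd i)    = bwd i
      swap-link (bwd i)    = fwd i

    -- Positions preserve atomic formulas.

    module _ {A B j m} {ρ ρ′ : Vec (Fin n) m} (P : Position A B j ρ ρ′) where

      private
        module P = Position P

        Far⇒¬Within-one : ∀ {S} (p : Vec (Carrier (M S)) P.pairs) {z} i → Far j p z →
                          ¬ Within 1 (value (lookup p i)) z
        Far⇒¬Within-one p i far (d , d≤1 , w) =
          <-irrefl refl (<-≤-trans (far i w) (≤-trans d≤1 (m^n>0 2 j)))

        Within-sym : ∀ {d u v} → Within d u v → Within d v u
        Within-sym (l , le , w) = l , le , reverse w

        ¬close : ∀ i i′ → ¬ Within 1 (value (lookup P.p i)) (value (lookup P.q i′))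
        ¬close i i′ = Close⇒¬Within-one {j = j} P.apart (P.close-p i) (P.close-q i′)

        Preserved : (u v u′ v′ : Fin n) → Set
        Preserved u v u′ v′ = (u ≡ v → u′ ≡ v′) × (u ~ v → u′ ~ v′)

        vacuous : ∀ {u v u′ v′} → ¬ Within 1 u v → Preserved u v u′ v′
        vacuous ¬w = (λ u≡v → contradiction (0 , z≤n , ≡⇒walk-zero u≡v) ¬w)
                   , (λ u~v → contradiction (1 , ≤-refl , u~v ∷ []) ¬w)

        -- Entries linked in the same way are handled by the identity or by the local game. Entries
        -- linked in different ways are more than one step apart, so they are neither equal nor
        -- adjacent.
        preserved : ∀ {u v u′ v′} → Link j P.p P.q u u′ → Link j P.p P.q v v′ → Preserved u v u′ v′
        preserved (stay _ _) (stay _ _) = (λ e → e) , (λ e → e)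
        preserved (stay f _) (fwd i)    = vacuous (Far⇒¬Within-one P.p i f ∘ Within-sym)
        preserved (stay _ g) (bwd i)    = vacuous (Far⇒¬Within-one P.q i g ∘ Within-sym)
        preserved (fwd i)    (stay f _) = vacuous (Far⇒¬Within-one P.p i f)
        preserved (bwd i)    (stay _ g) = vacuous (Far⇒¬Within-one P.q i g)
        preserved (fwd i)    (fwd i′)   =
          (λ e → cong value (to (same-≡ (atoms P.local) i i′) (value-injective e))) , to (same-edge (atoms P.local) i i′)
        preserved (bwd i)    (bwd i′)   =
          (λ e → cong value (from (same-≡ (atoms P.local) i i′) (value-injective e))) , from (same-edge (atoms P.local) i i′)
        preserved (fwd i)    (bwd i′)   = vacuous (¬close i i′)
        preserved (bwd i)    (fwd i′)   = vacuous (¬close i′ i ∘ Within-sym)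

        same-link-color : ∀ a {u u′} → Link j P.p P.q u u′ → u ∈ color G a → u′ ∈ color G a
        -- In the balls color `zero` is the new predicate, so color `a` of `G` has index `suc a`.
        same-link-color a (stay _ _) = λ u∈ → u∈
        same-link-color a (fwd i)    = to (same-color (atoms P.local) (suc a) i)
        same-link-color a (bwd i)    = from (same-color (atoms P.local) (suc a) i)

      preserves-≡ : ∀ i i′ → lookup ρ i ≡ lookup ρ i′ → lookup ρ′ i ≡ lookup ρ′ i′
      preserves-≡ i i′ = proj₁ (preserved (P.links i) (P.links i′))

      preserves-~ : ∀ i i′ → lookup ρ i ~ lookup ρ i′ → lookup ρ′ i ~ lookup ρ′ i′
      preserves-~ i i′ = proj₂ (preserved (P.links i) (P.links i′))

      preserves-color : ∀ a i → lookup ρ i ∈ color G a → lookup ρ′ i ∈ color G a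
      preserves-color a i = same-link-color a (P.links i)

    Position⇒SameAtoms : ∀ {A B j m} {ρ ρ′ : Vec (Fin n) m} → Position A B j ρ ρ′ → SameAtoms ⟦ G ⟧ ⟦ G ⟧ ρ ρ′
    Position⇒SameAtoms P = record
      { same-≡     = λ i i′ → mk⇔ (preserves-≡ P i i′) (preserves-≡ (swap-sides P) i i′)
      ; same-edge  = λ i i′ → mk⇔ (preserves-~ P i i′) (preserves-~ (swap-sides P) i i′)
      ; same-color = λ a i → mk⇔ (preserves-color P a i) (preserves-color (swap-sides P) a i)
      }

    -- Duplicator's replies.

    answer-near : ∀ {A B j m} {ρ ρ′ : Vec (Fin n) m} (P : Position A B (suc j) ρ ρ′) x →
                  Near j (Position.p P) x → ∃ λ y → Position A B j (x ∷ ρ) (y ∷ ρ′)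
    answer-near {A} {B} {j} {ρ = ρ} {ρ′} P x (i , d , d≤ , w) = value y , record
      { p = x̂ ∷ P.p ; q = y ∷ P.q ; apart = P.apart ; local = bf
      ; close-p = λ { zero → close-x ; (suc i′) → Close-pred {j} (P.close-p i′) }
      ; close-q = λ { zero → Close-extend {j} (P.close-q i) d≤ w′ ; (suc i′) → Close-pred {j} (P.close-q i′) }
      ; links   = λ { zero → fwd zero ; (suc i′) → link (P.links i′) }
      }
      where
      module P = Position P
      close-x : Close j A x
      close-x = Close-extend {j} (P.close-p i) d≤ w
      x̂ : Carrier (M A)
      x̂ = x , irr (Close⇒N {j} close-x)
      y : Carrier (M B)
      y = proj₁ (forth P.local x̂)
      bf : BackForth (M A) (M B) j (x̂ ∷ P.p) (y ∷ P.q)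
      bf = proj₂ (forth P.local x̂)
      -- The reply is as near to `q` at `i` as the move is to `p` at `i`. This gives closeness to
      -- `B` and keeps the staying vertices far from the reply.
      w′ : Walk G d (value (lookup P.q i)) (value y)
      w′ = let s , e , s∈ , le , w₀ = P.close-p i
           in BackForth-walk bf (suc i) zero s∈ w₀
                (∸-monoˡ-≤ 1 (Close⇒< {j} (Close-extend {j} (s , e , s∈ , le , w₀) d≤ w))) d≤ w
      link : ∀ {u v} → Link (suc j) P.p P.q u v → Link j (x̂ ∷ P.p) (y ∷ P.q) u v
      link (stay f g) = stay (Far-extend {j} {p = P.p} i d≤ w f) (Far-extend {j} {p = P.q} i d≤ w′ g)
      link (fwd i′)   = fwd (suc i′)
      link (bwd i′)   = bwd (suc i′)

    -- No local move is made, so the local game just gives up a round.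
    answer-far : ∀ {A B j m} {ρ ρ′ : Vec (Fin n) m} (P : Position A B (suc j) ρ ρ′) x →
                 Far j (Position.p P) x → Far j (Position.q P) x → Position A B j (x ∷ ρ) (x ∷ ρ′)
    answer-far {j = j} P x far-p far-q = record
      { p = P.p ; q = P.q ; apart = P.apart ; local = BackForth-pred P.local
      ; close-p = λ i → Close-pred {j} (P.close-p i)
      ; close-q = λ i → Close-pred {j} (P.close-q i)
      ; links   = λ { zero → stay far-p far-q ; (suc i) → link (P.links i) }
      }
      where
      module P = Position P
      link : ∀ {u v} → Link (suc j) P.p P.q u v → Link j P.p P.q u v
      link (stay f g) = stay (Far-pred {j} {p = P.p} f) (Far-pred {j} {p = P.q} g)
      link (fwd i)    = fwd i
      link (bwd i)    = bwd i

    answer : ∀ {A B j m} {ρ ρ′ : Vec (Fin n) m} → Position A B (suc j) ρ ρ′ →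
             ∀ x → ∃ λ y → Position A B j (x ∷ ρ) (y ∷ ρ′)
    answer {j = j} P x with near? j (Position.p P) x | near? j (Position.q P) x
    ... | yes near | _        = answer-near P x near
    ... | no _     | yes near = let y , P′ = answer-near (swap-balls P) x near in y , swap-balls P′
    ... | no far   | no far′  =
      x , answer-far P x (¬Near⇒Far {j = j} {p = Position.p P} far) (¬Near⇒Far {j = j} {p = Position.q P} far′)

    Position⇒BackForth : ∀ {A B j m} {ρ ρ′ : Vec (Fin n) m} → Position A B j ρ ρ′ → BackForth ⟦ G ⟧ ⟦ G ⟧ j ρ ρ′
    Position⇒BackForth {j = zero}  P = stop (Position⇒SameAtoms P)
    Position⇒BackForth {j = suc j} P = step (Position⇒SameAtoms P)
      (λ x → let y , P′ = answer P x in y , Position⇒BackForth P′)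
      (λ y → let x , P′ = answer (swap-sides P) y in x , Position⇒BackForth (swap-sides P′))

    initial : ∀ {A B} → Dist> G (_∈ A) (_∈ B) (2 ^ suc k) →
              ∀ {m} (w : Vec (Fin n) m) → Dist≥ G (_∈ᵥ w) (_∈ (A ∪ B)) (2 ^ suc k) →
              (a : Carrier (M A)) (b : Carrier (M B)) → value a ∈ A → value b ∈ B →
              BackForth (M A) (M B) k (a ∷ []) (b ∷ []) → Position A B k (value a ∷ w) (value b ∷ w)
    initial {A} {B} apart w dist a b a∈A b∈B bf = record
      { p = a ∷ [] ; q = b ∷ [] ; apart = apart ; local = bf
      -- The whole budget `2 ^ k` is still in reserve.
      ; close-p = λ { zero → _ , 0 , a∈A , ≤-refl , [] }
      ; close-q = λ { zero → _ , 0 , b∈B , ≤-refl , [] }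
      ; links   = λ { zero    → fwd zero
                    ; (suc i) → stay (λ { zero p → far i (p⊆p∪q B a∈A) p })
                                     (λ { zero p → far i (q⊆p∪q A B b∈B) p }) }
      }
      where
      far : ∀ i {v d} → v ∈ A ∪ B → Walk G d v (lookup w i) → 2 ^ k < d
      -- Since `2 ^ k` is at least one, distance at least `2 ^ suc k` exceeds `2 ^ k`.
      far i v∈ p = ≤-trans (subst (suc (2 ^ k) ≤_) (sym (2^suc k)) (+-monoˡ-≤ (2 ^ k) (m^n>0 2 k)))
        (dist (∈-lookup i w) v∈ (reverse p))

theorem4p2 : ∀ (k : ℕ) → 1 ≤ k →
    ∀ {c n : ℕ} (G : Graph c n) (A B : Subset n) →
    Dist> G (_∈ A) (_∈ B) (2 ^ k) →
    tp k ((G ⟨X↦ A ⟩) [ N[ 2 ^ (k ∸ 1) ∸ 1 ] G A ]) ≐ tp k ((G ⟨X↦ B ⟩) [ N[ 2 ^ (k ∸ 1) ∸ 1 ] G B ]) →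
    ∀ {m : ℕ} (w : Vec (Fin n) m) →
    Dist≥ G (_∈ᵥ w) (_∈ (A ∪ B)) (2 ^ k) →
    ∀ (φ : Formula c (suc m)) → qr φ ≤ k ∸ 1 →
    (⟦ G ⟨X↦ A ⟩ ⟧ ⊨ ∃∈X (weaken φ) at w) ⇔ (⟦ G ⟨X↦ B ⟩ ⟧ ⊨ ∃∈X (weaken φ) at w)
theorem4p2 (suc k) _ G A B apart (tpA⊆tpB , _) w dist φ qrφ≤k = mk⇔
  (λ (a , a∈A , t) →
    let b , bf = forth game (a , irr (a , 0 , a∈A , z≤n , []))
        -- Color `zero` is interpreted as `A` on the left and as `B` on the right.
        b∈B    = to (same-color (atoms bf) zero zero) a∈A
    in  value b , b∈B , to (transfer _ b a∈A b∈B bf) t)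
  (λ (b , b∈B , t) →
    let a , bf = back game (b , irr (b , 0 , b∈B , z≤n , []))
        a∈A    = from (same-color (atoms bf) zero zero) b∈B
    in  value a , a∈A , from (transfer a _ a∈A b∈B bf) t)
  where
  r = 2 ^ k ∸ 1
  -- The first of the `suc k` rounds picks the witness; the other `k` match the rank bound on `φ`.
  game : BackForth (Ball G r A) (Ball G r B) (suc k) [] []
  game = tp⊆⇒BackForth (induced-finite G (G ⟨X↦ A ⟩) (N? G r A)) (induced-finite G (G ⟨X↦ B ⟩) (N? G r B))
           (suc k) (λ {σ} → tpA⊆tpB {σ})
  transfer : (a : Carrier (Ball G r A)) (b : Carrier (Ball G r B)) → value a ∈ A → value b ∈ B →
             BackForth (Ball G r A) (Ball G r B) k (a ∷ []) (b ∷ []) →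
             (⟦ G ⟨X↦ A ⟩ ⟧ ⊨ weaken φ at (value a ∷ w)) ⇔ (⟦ G ⟨X↦ B ⟩ ⟧ ⊨ weaken φ at (value b ∷ w))
  -- After removing the new predicate, both sides speak of the same structure `G`, where the global
  -- strategy applies.
  transfer a b a∈A b∈B bf = ⇔-sym (weaken-⊨ G B φ)
    ⇔-∘ (BackForth⇒⊨ (Position⇒BackForth G k (initial G k apart w dist a b a∈A b∈B bf)) φ qrφ≤k
    ⇔-∘ weaken-⊨ G A φ)
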